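{- For any integer $k\ge 3$, every online algorithm for bin packing with cardinality constraint $k$ has asymptotic competitive ratio at least $$\frac{2k+k^2-k^3+\sqrt{k^6-2k^5-3k^4+12k^3-12k^2+4k}}{2}.$$
   Context: Bin packing with cardinality constraints (CCBP) with integer parameter $k\ge 2$: items with sizes in $(0,1]$ must be partitioned into bins so that each bin has total size at most $1$ and contains at most $k$ items. In the online version items arrive one by one and each must be irrevocably packed (into a new bin or a non-empty bin, respecting both constraints) before the next item arrives. For an input $L$, $A(L)$ denotes the number of bins used by algorithm $A$ and $OPT(L)$ the minimum possible number of bins. The asymptotic competitive ratio of $A$ is $\lim_{K\to\infty}\sup\{A(L)/OPT(L): OPT(L)\ge K\}$. -}

module Defs where

open import Data.Nat using (ℕ; _≤_; _<_)
open import Data.Integer using (ℤ; +_)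
import Data.Integer as ℤ
open import Data.Rational using (ℚ; 0ℚ; 1ℚ; _/_)
import Data.Rational as ℚ
open import Data.List using (List; []; _∷_; _++_; [_]; length; foldr; concat; lookup; updateAt)
open import Data.List.Relation.Unary.All using (All)
open import Data.List.Relation.Binary.Permutation.Propositional using (_↭_)
open import Data.Fin using (Fin)
open import Data.Product using (Σ; _×_; ∃; _,_)
open import Data.Sum using (_⊎_; inj₁; inj₂)
open import Data.Unit using (⊤)
open import Relation.Binary.PropositionalEquality using (_≡_)

ValidItem : ℚ → Set
ValidItem x = (0ℚ ℚ.< x) × (x ℚ.≤ 1ℚ)

Bin : Set
Bin = List ℚ

sumℚ : List ℚ → ℚ
sumℚ = foldr ℚ._+_ 0ℚ

BinOK : ℕ → Bin → Set
BinOK k b = (length b ≤ k) × (sumℚ b ℚ.≤ 1ℚ)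

Fits : ℕ → Bin → ℚ → Set
Fits k b x = (length b < k) × (sumℚ b ℚ.+ x ℚ.≤ 1ℚ)

-- a decision of the online algorithm: open a new bin, or put the item
-- into an existing bin where it fits
Choice : ℕ → List Bin → ℚ → Set
Choice k bins x = ⊤ ⊎ Σ (Fin (length bins)) (λ i → Fits k (lookup bins i) x)

OnlineAlg : ℕ → Set
OnlineAlg k = (history : List ℚ) → (bins : List Bin) → (x : ℚ) → Choice k bins x

place : ∀ {k} (bins : List Bin) (x : ℚ) → Choice k bins x → List Bin
place bins x (inj₁ _) = bins ++ [ x ∷ [] ]
place bins x (inj₂ (i , _)) = updateAt bins i (x ∷_)

run : ∀ {k} → OnlineAlg k → List ℚ → List Bin → List ℚ → List Bin
run A hist bins [] = bins
run A hist bins (x ∷ xs) = run A (hist ++ [ x ]) (place bins x (A hist bins x)) xs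

cost : ∀ {k} → OnlineAlg k → List ℚ → ℕ
cost A L = length (run A [] [] L)

IsPacking : ℕ → List ℚ → List Bin → Set
IsPacking k L P = (concat P ↭ L) × All (BinOK k) P

IsOPT : ℕ → List ℚ → ℕ → Set
IsOPT k L m = (∃ λ P → IsPacking k L P × length P ≡ m) × (∀ P → IsPacking k L P → m ≤ length P)

ℕtoℚ : ℕ → ℚ
ℕtoℚ n = (+ n) / 1

ℤtoℚ : ℤ → ℚ
ℤtoℚ z = z / 1

boundA : ℕ → ℤ
boundA k = let z = + k in (+ 2) ℤ.* z ℤ.+ z ℤ.* z ℤ.- z ℤ.* z ℤ.* z

boundD : ℕ → ℤ
boundD k = let z = + k ; z2 = z ℤ.* z ; z3 = z2 ℤ.* z ; z4 = z3 ℤ.* z ; z5 = z4 ℤ.* z ; z6 = z5 ℤ.* z in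
  z6 ℤ.- (+ 2) ℤ.* z5 ℤ.- (+ 3) ℤ.* z4 ℤ.+ (+ 12) ℤ.* z3 ℤ.- (+ 12) ℤ.* z2 ℤ.+ (+ 4) ℤ.* z

-- q < (a(k) + √D(k)) / 2, written out without square roots:
-- 2q − a < √D  ⇔  2q − a < 0  or  (2q − a)² < D     (D ≥ 0 for k ≥ 3)
BelowBound : ℕ → ℚ → Set
BelowBound k q = let t = ℚtwo ℚ.* q ℚ.- ℤtoℚ (boundA k) in
  (t ℚ.< 0ℚ) ⊎ (t ℚ.* t ℚ.< ℤtoℚ (boundD k))
  where ℚtwo = (+ 2) / 1

{-# OPTIONS --safe #-}

-- The adversary sends N = M (k - 1) tiny items, with every size chosen so that the items opening a bin
-- turn out to be much larger than all others. Let X be the number of bins opened.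
-- Then come huge items, all of one size, no two of which share a bin. There are two possible sizes.
-- * M items that fit with any k - 1 tiny items: OPT = M, but every full bin is useless to the algorithm,
--   and there are at least (k - 1)(M - X) of those.
-- * (N - X) / (k - 1) items that fit with k - 1 small items but with no large one: now all X bins are
--   useless, while OPT is the number of items divided by k, rounded up.
-- If X is small the first continuation costs more than q OPT, if X is large the second one does; the
-- bound of the theorem is the value of q at which the two thresholds on X meet.

module Submission where

open import Defs
open import Data.Nat using (ℕ; _≤_)
open import Data.Rational using (ℚ; _<_; _*_)
open import Data.List using (List)
open import Data.List.Relation.Unary.All using (All)
open import Data.Product using (Σ; ∃; _×_)

open import Algebra.Bundles using (CommutativeMonoid)
open import Data.Fin using (Fin; zero; suc)
open import Data.Integer as ℤ using (+_; -[1+_])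
import Data.Integer.Properties as ℤ
import Data.Integer.Tactic.RingSolver as ℤ-Solver
open import Data.List using ([]; _∷_; _++_; [_]; length; concat; lookup; updateAt; filter; replicate; take; drop)
open import Data.List.Properties
open import Data.List.Relation.Binary.Permutation.Propositional using (_↭_; ↭-refl; ↭-sym; ↭-trans; ↭-reflexive; prep; module PermutationReasoning)
import Data.List.Relation.Binary.Permutation.Propositional.Properties as ↭
open import Data.List.Relation.Unary.All as All using ([]; _∷_)
import Data.List.Relation.Unary.All.Properties as All
open import Data.Nat as ℕ using (zero; suc; s≤s; z≤n)
import Data.Nat.DivMod as ℕ
import Data.Nat.Properties as ℕ
import Data.Nat.Tactic.RingSolver as ℕ-Solver
open import Data.Product using (_,_; proj₁; proj₂)
open import Data.Rational as ℚ using (0ℚ; 1ℚ; _+_; _-_; -_; 1/_; toℚᵘ; mkℚ)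
open import Data.Rational.Properties
open import Data.Rational.Unnormalised as ℚᵘ using (mkℚᵘ; *≡*; *≤*; *<*) renaming (_≃_ to _≃ᵘ_)
import Data.Rational.Unnormalised.Properties as ℚᵘ
open import Data.Sum using (inj₁; inj₂; [_,_]′)
open import Level using (0ℓ)
open import Relation.Binary.PropositionalEquality using (_≡_; refl; sym; trans; cong; cong₂; subst; subst₂; module ≡-Reasoning)
open import Relation.Nullary using (Dec; ¬_; yes; no; contradiction; ¬?; _×-dec_)
open import Relation.Unary using (Pred)

-- Embedding naturals and integers into the rationals, and clearing denominators.

<⇒≱ : ∀ {x y} → x < y → ¬ (y ℚ.≤ x)
<⇒≱ x<y y≤x = <-irrefl refl (<-≤-trans x<y y≤x)

toℚᵘ-ℤtoℚ : ∀ i → toℚᵘ (ℤtoℚ i) ≃ᵘ mkℚᵘ i 0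
toℚᵘ-ℤtoℚ i = toℚᵘ-fromℚᵘ (mkℚᵘ i 0)

ℤtoℚ-neg : ∀ i → ℤtoℚ (ℤ.- i) ≡ - ℤtoℚ i
ℤtoℚ-neg i = toℚᵘ-injective (begin
  toℚᵘ (ℤtoℚ (ℤ.- i))   ≈⟨ toℚᵘ-ℤtoℚ (ℤ.- i) ⟩
  ℚᵘ.- mkℚᵘ i 0         ≈⟨ ℚᵘ.-‿cong (toℚᵘ-ℤtoℚ i) ⟨
  ℚᵘ.- toℚᵘ (ℤtoℚ i)    ≈⟨ toℚᵘ-homo‿- (ℤtoℚ i) ⟨
  toℚᵘ (- ℤtoℚ i)       ∎)
  where open ℚᵘ.≃-Reasoning

ℕtoℚ-+ : ∀ m n → ℕtoℚ (m ℕ.+ n) ≡ ℕtoℚ m + ℕtoℚ n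
ℕtoℚ-+ m n = toℚᵘ-injective (begin
  toℚᵘ (ℕtoℚ (m ℕ.+ n))              ≈⟨ toℚᵘ-ℤtoℚ (+ (m ℕ.+ n)) ⟩
  mkℚᵘ (+ m ℤ.+ + n) 0               ≡⟨ cong₂ (λ i j → mkℚᵘ (i ℤ.+ j) 0) (ℤ.*-identityʳ (+ m)) (ℤ.*-identityʳ (+ n)) ⟨
  mkℚᵘ (+ m) 0 ℚᵘ.+ mkℚᵘ (+ n) 0     ≈⟨ ℚᵘ.+-cong (toℚᵘ-ℤtoℚ (+ m)) (toℚᵘ-ℤtoℚ (+ n)) ⟨
  toℚᵘ (ℕtoℚ m) ℚᵘ.+ toℚᵘ (ℕtoℚ n)   ≈⟨ toℚᵘ-homo-+ (ℕtoℚ m) (ℕtoℚ n) ⟨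
  toℚᵘ (ℕtoℚ m + ℕtoℚ n)             ∎)
  where open ℚᵘ.≃-Reasoning

ℕtoℚ-* : ∀ m n → ℕtoℚ (m ℕ.* n) ≡ ℕtoℚ m * ℕtoℚ n
ℕtoℚ-* m n = toℚᵘ-injective (begin
  toℚᵘ (ℕtoℚ (m ℕ.* n))              ≈⟨ toℚᵘ-ℤtoℚ (+ (m ℕ.* n)) ⟩
  mkℚᵘ (+ (m ℕ.* n)) 0               ≡⟨ cong (λ i → mkℚᵘ i 0) (ℤ.pos-* m n) ⟩
  mkℚᵘ (+ m) 0 ℚᵘ.* mkℚᵘ (+ n) 0     ≈⟨ ℚᵘ.*-cong (toℚᵘ-ℤtoℚ (+ m)) (toℚᵘ-ℤtoℚ (+ n)) ⟨
  toℚᵘ (ℕtoℚ m) ℚᵘ.* toℚᵘ (ℕtoℚ n)   ≈⟨ toℚᵘ-homo-* (ℕtoℚ m) (ℕtoℚ n) ⟨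
  toℚᵘ (ℕtoℚ m * ℕtoℚ n)             ∎)
  where open ℚᵘ.≃-Reasoning

ℕtoℚ-mono-≤ : ∀ {m n} → m ≤ n → ℕtoℚ m ℚ.≤ ℕtoℚ n
ℕtoℚ-mono-≤ {m} {n} m≤n = toℚᵘ-cancel-≤ (begin
  toℚᵘ (ℕtoℚ m)   ≃⟨ toℚᵘ-ℤtoℚ (+ m) ⟩
  mkℚᵘ (+ m) 0    ≤⟨ *≤* (ℤ.*-monoʳ-≤-nonNeg (+ 1) (ℤ.+≤+ m≤n)) ⟩
  mkℚᵘ (+ n) 0    ≃⟨ toℚᵘ-ℤtoℚ (+ n) ⟨
  toℚᵘ (ℕtoℚ n)   ∎)
  where open ℚᵘ.≤-Reasoning

ℕtoℚ-mono-< : ∀ {m n} → m ℕ.< n → ℕtoℚ m < ℕtoℚ n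
ℕtoℚ-mono-< {m} {n} m<n = toℚᵘ-cancel-< (begin-strict
  toℚᵘ (ℕtoℚ m)   ≃⟨ toℚᵘ-ℤtoℚ (+ m) ⟩
  mkℚᵘ (+ m) 0    <⟨ *<* (ℤ.*-monoʳ-<-pos (+ 1) (ℤ.+<+ m<n)) ⟩
  mkℚᵘ (+ n) 0    ≃⟨ toℚᵘ-ℤtoℚ (+ n) ⟨
  toℚᵘ (ℕtoℚ n)   ∎)
  where open ℚᵘ.≤-Reasoning

ℕtoℚ-cancel-< : ∀ {m n} → ℕtoℚ m < ℕtoℚ n → m ℕ.< n
ℕtoℚ-cancel-< {m} {n} m<n = ℕ.≰⇒> λ n≤m → <⇒≱ m<n (ℕtoℚ-mono-≤ n≤m)

q*denominator≡numerator : ∀ q {p} → ℚ.↥ q ≡ + p → q * ℕtoℚ (ℚ.↧ₙ q) ≡ ℕtoℚ p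
q*denominator≡numerator q@(mkℚ (+ p) d-1 _) refl = toℚᵘ-injective (begin
  toℚᵘ (q * ℕtoℚ d)                  ≈⟨ toℚᵘ-homo-* q (ℕtoℚ d) ⟩
  toℚᵘ q ℚᵘ.* toℚᵘ (ℕtoℚ d)          ≈⟨ ℚᵘ.*-congˡ {toℚᵘ q} (toℚᵘ-ℤtoℚ (+ d)) ⟩
  mkℚᵘ (+ p) d-1 ℚᵘ.* mkℚᵘ (+ d) 0   ≈⟨ *≡* (trans (ℤ.*-identityʳ (+ p ℤ.* + d)) (cong (λ n → + p ℤ.* + n) (sym (ℕ.*-identityʳ d)))) ⟩
  mkℚᵘ (+ p) 0                       ≈⟨ toℚᵘ-ℤtoℚ (+ p) ⟨
  toℚᵘ (ℕtoℚ p)                      ∎)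
  where
  open ℚᵘ.≃-Reasoning
  d = suc d-1

ℕtoℚ-positive : ∀ n .{{_ : ℕ.NonZero n}} → ℚ.Positive (ℕtoℚ n)
ℕtoℚ-positive (suc n) = ℚ.positive (ℕtoℚ-mono-< {0} {suc n} (s≤s z≤n))

q*m<n : ∀ q {p m n} → ℚ.↥ q ≡ + p → p ℕ.* m ℕ.< ℚ.↧ₙ q ℕ.* n → q * ℕtoℚ m < ℕtoℚ n
q*m<n q {p} {m} {n} ↥q≡p pm<dn = *-cancelʳ-<-nonNeg (ℕtoℚ d) {{pos⇒nonNeg (ℕtoℚ d) {{ℕtoℚ-positive d}}}} (begin-strict
  q * ℕtoℚ m * ℕtoℚ d     ≡⟨ *-assoc q (ℕtoℚ m) (ℕtoℚ d) ⟩
  q * (ℕtoℚ m * ℕtoℚ d)   ≡⟨ cong (q *_) (*-comm (ℕtoℚ m) (ℕtoℚ d)) ⟩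
  q * (ℕtoℚ d * ℕtoℚ m)   ≡⟨ *-assoc q (ℕtoℚ d) (ℕtoℚ m) ⟨
  q * ℕtoℚ d * ℕtoℚ m     ≡⟨ cong (_* ℕtoℚ m) (q*denominator≡numerator q ↥q≡p) ⟩
  ℕtoℚ p * ℕtoℚ m         ≡⟨ ℕtoℚ-* p m ⟨
  ℕtoℚ (p ℕ.* m)          <⟨ ℕtoℚ-mono-< pm<dn ⟩
  ℕtoℚ (d ℕ.* n)          ≡⟨ cong ℕtoℚ (ℕ.*-comm d n) ⟩
  ℕtoℚ (n ℕ.* d)          ≡⟨ ℕtoℚ-* n d ⟩
  ℕtoℚ n * ℕtoℚ d         ∎)
  where
  open ≤-Reasoning
  d = ℚ.↧ₙ q

-- The bound as an inequality between natural numbers.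

-- With k = 2 + j, a number q ≥ 0 lies below the bound exactly when q² + coefficient j * q < constant j.
coefficient constant : ℕ → ℕ
coefficient j = (2 ℕ.+ j) ℕ.* j ℕ.* (3 ℕ.+ j)
constant j    = 2 ℕ.* (2 ℕ.+ j) ℕ.* (2 ℕ.+ j) ℕ.* j ℕ.+ (2 ℕ.+ j)

pos-coefficient : ∀ j → + coefficient j ≡ (+ 2 ℤ.+ + j) ℤ.* + j ℤ.* (+ 3 ℤ.+ + j)
pos-coefficient j = trans (ℤ.pos-* ((2 ℕ.+ j) ℕ.* j) (3 ℕ.+ j)) (cong (ℤ._* (+ 3 ℤ.+ + j)) (ℤ.pos-* (2 ℕ.+ j) j))

pos-constant : ∀ j → + constant j ≡ + 2 ℤ.* (+ 2 ℤ.+ + j) ℤ.* (+ 2 ℤ.+ + j) ℤ.* + j ℤ.+ (+ 2 ℤ.+ + j)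
pos-constant j = cong (ℤ._+ + k) (trans (ℤ.pos-* (2 ℕ.* k ℕ.* k) j)
    (cong (ℤ._* + j) (trans (ℤ.pos-* (2 ℕ.* k) k) (cong (ℤ._* + k) (ℤ.pos-* 2 k)))))
  where k = 2 ℕ.+ j

boundA≡ : ∀ j → boundA (2 ℕ.+ j) ≡ ℤ.- + coefficient j
boundA≡ j = trans (identity (+ j)) (cong ℤ.-_ (sym (pos-coefficient j)))
  where
  identity : ∀ x → let z = + 2 ℤ.+ x in
    + 2 ℤ.* z ℤ.+ z ℤ.* z ℤ.- z ℤ.* z ℤ.* z ≡ ℤ.- (z ℤ.* x ℤ.* (+ 3 ℤ.+ x))
  identity = ℤ-Solver.solve-∀

-- This is the discriminant of `q² + C q = E` with `C = coefficient j` and `E = constant j`. As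
-- `boundA` is `- C`, the bound of the theorem is the larger root of this equation.
boundD≡ : ∀ j → boundD (2 ℕ.+ j) ≡ + (coefficient j ℕ.* coefficient j ℕ.+ 4 ℕ.* constant j)
boundD≡ j = trans (identity (+ j)) (sym (trans
    (cong₂ ℤ._+_ (ℤ.pos-* (coefficient j) (coefficient j)) (ℤ.pos-* 4 (constant j)))
    (cong₂ (λ x y → x ℤ.* x ℤ.+ + 4 ℤ.* y) (pos-coefficient j) (pos-constant j))))
  where
  identity : ∀ x →
    (let z = + 2 ℤ.+ x ; z2 = z ℤ.* z ; z3 = z2 ℤ.* z ; z4 = z3 ℤ.* z ; z5 = z4 ℤ.* z ; z6 = z5 ℤ.* z in
    z6 ℤ.- (+ 2) ℤ.* z5 ℤ.- (+ 3) ℤ.* z4 ℤ.+ (+ 12) ℤ.* z3 ℤ.- (+ 12) ℤ.* z2 ℤ.+ (+ 4) ℤ.* z) ≡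
    (let z = + 2 ℤ.+ x ; c = z ℤ.* x ℤ.* (+ 3 ℤ.+ x) in
    c ℤ.* c ℤ.+ + 4 ℤ.* (+ 2 ℤ.* z ℤ.* z ℤ.* x ℤ.+ z))
  identity = ℤ-Solver.solve-∀

-- Since `boundA` is `- C`, the number `t` scaled by `d` is the natural number `2 p + C d`, so
-- `t < 0` is impossible. Squaring leaves `C² d²` on both sides, and then a common factor 4.
BelowBound⇒ : ∀ j q {p} → ℚ.↥ q ≡ + p → BelowBound (2 ℕ.+ j) q → let d = ℚ.↧ₙ q in
  p ℕ.* p ℕ.+ p ℕ.* d ℕ.* coefficient j ℕ.< d ℕ.* d ℕ.* constant j
BelowBound⇒ j q {p} ↥q≡p below = ℕ.*-cancelˡ-< 4 _ _ (ℕ.+-cancelʳ-< (d ℕ.* d ℕ.* (C ℕ.* C)) _ _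
    (subst₂ ℕ._<_ (lhs p d C) (rhs d C (constant j)) (ℕtoℚ-cancel-< (scaled below))))
  where
  d = ℚ.↧ₙ q
  C = coefficient j
  two = + 2 ℚ./ 1
  t = two * q - ℤtoℚ (boundA (2 ℕ.+ j))
  lhs : ∀ p d C → (2 ℕ.* p ℕ.+ C ℕ.* d) ℕ.* (2 ℕ.* p ℕ.+ C ℕ.* d) ≡ 4 ℕ.* (p ℕ.* p ℕ.+ p ℕ.* d ℕ.* C) ℕ.+ d ℕ.* d ℕ.* (C ℕ.* C)
  lhs = ℕ-Solver.solve-∀
  rhs : ∀ d C E → (C ℕ.* C ℕ.+ 4 ℕ.* E) ℕ.* (d ℕ.* d) ≡ 4 ℕ.* (d ℕ.* d ℕ.* E) ℕ.+ d ℕ.* d ℕ.* (C ℕ.* C)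
  rhs = ℕ-Solver.solve-∀
  n = 2 ℕ.* p ℕ.+ C ℕ.* d
  t*d≡n : t * ℕtoℚ d ≡ ℕtoℚ n
  t*d≡n = begin
    t * ℕtoℚ d                             ≡⟨ cong (λ i → (two * q - ℤtoℚ i) * ℕtoℚ d) (boundA≡ j) ⟩
    (two * q - ℤtoℚ (ℤ.- + C)) * ℕtoℚ d    ≡⟨ cong (λ r → (two * q - r) * ℕtoℚ d) (ℤtoℚ-neg (+ C)) ⟩
    (two * q - - ℕtoℚ C) * ℕtoℚ d          ≡⟨ cong (λ r → (two * q + r) * ℕtoℚ d) (neg-involutive (ℕtoℚ C)) ⟩
    (two * q + ℕtoℚ C) * ℕtoℚ d            ≡⟨ *-distribʳ-+ (ℕtoℚ d) (two * q) (ℕtoℚ C) ⟩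
    two * q * ℕtoℚ d + ℕtoℚ C * ℕtoℚ d     ≡⟨ cong (_+ ℕtoℚ C * ℕtoℚ d) (*-assoc two q (ℕtoℚ d)) ⟩
    two * (q * ℕtoℚ d) + ℕtoℚ C * ℕtoℚ d   ≡⟨ cong (λ r → two * r + ℕtoℚ C * ℕtoℚ d) (q*denominator≡numerator q ↥q≡p) ⟩
    two * ℕtoℚ p + ℕtoℚ C * ℕtoℚ d         ≡⟨ cong₂ _+_ (ℕtoℚ-* 2 p) (ℕtoℚ-* C d) ⟨
    ℕtoℚ (2 ℕ.* p) + ℕtoℚ (C ℕ.* d)        ≡⟨ ℕtoℚ-+ (2 ℕ.* p) (C ℕ.* d) ⟨
    ℕtoℚ n                                 ∎
    where
    open ≡-Reasoning
    neg-involutive : ∀ r → - - r ≡ r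
    neg-involutive = ⁻¹-involutive
      where open import Algebra.Properties.Group +-0-group
  D = ℤtoℚ (boundD (2 ℕ.+ j))
  t²<D⇒ : t * t < D → ℕtoℚ (n ℕ.* n) < ℕtoℚ ((C ℕ.* C ℕ.+ 4 ℕ.* constant j) ℕ.* (d ℕ.* d))
  t²<D⇒ t²<D = begin-strict
    ℕtoℚ (n ℕ.* n)                                         ≡⟨ ℕtoℚ-* n n ⟩
    ℕtoℚ n * ℕtoℚ n                                        ≡⟨ cong (λ r → r * r) t*d≡n ⟨
    t * ℕtoℚ d * (t * ℕtoℚ d)                              ≡⟨ interchange t (ℕtoℚ d) t (ℕtoℚ d) ⟩
    t * t * (ℕtoℚ d * ℕtoℚ d)                              ≡⟨ cong (t * t *_) (ℕtoℚ-* d d) ⟨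
    t * t * ℕtoℚ (d ℕ.* d)                                 <⟨ *-monoˡ-<-pos (ℕtoℚ (d ℕ.* d)) {{ℕtoℚ-positive (d ℕ.* d)}} t²<D ⟩
    D * ℕtoℚ (d ℕ.* d)                                     ≡⟨ cong (λ i → ℤtoℚ i * ℕtoℚ (d ℕ.* d)) (boundD≡ j) ⟩
    ℕtoℚ (C ℕ.* C ℕ.+ 4 ℕ.* constant j) * ℕtoℚ (d ℕ.* d)   ≡⟨ ℕtoℚ-* (C ℕ.* C ℕ.+ 4 ℕ.* constant j) (d ℕ.* d) ⟨
    ℕtoℚ ((C ℕ.* C ℕ.+ 4 ℕ.* constant j) ℕ.* (d ℕ.* d))    ∎
    where
    open ≤-Reasoning
    open import Algebra.Properties.CommutativeSemigroup (CommutativeMonoid.commutativeSemigroup *-1-commutativeMonoid) using (interchange)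
  scaled : BelowBound (2 ℕ.+ j) q → ℕtoℚ (n ℕ.* n) < ℕtoℚ ((C ℕ.* C ℕ.+ 4 ℕ.* constant j) ℕ.* (d ℕ.* d))
  scaled (inj₂ t²<D) = t²<D⇒ t²<D
  scaled (inj₁ t<0)  = contradiction (begin-strict
    ℕtoℚ n        ≡⟨ t*d≡n ⟨
    t * ℕtoℚ d    <⟨ *-monoˡ-<-pos (ℕtoℚ d) {{ℕtoℚ-positive d}} t<0 ⟩
    0ℚ * ℕtoℚ d   ≡⟨ *-zeroˡ (ℕtoℚ d) ⟩
    0ℚ            ∎) λ n<0 → <⇒≱ n<0 (ℕtoℚ-mono-≤ {0} {n} z≤n)
    where open ≤-Reasoning

-- Arithmetic of the second continuation.

-- The product `(b - a) (y - x)` is nonnegative; the form avoids subtraction.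
rearrangement : ∀ {a b x y} → a ≤ b → x ≤ y → y ℕ.* a ℕ.+ x ℕ.* b ≤ y ℕ.* b ℕ.+ x ℕ.* a
rearrangement {a} {b} {x} {y} a≤b x≤y = begin
  y ℕ.* a ℕ.+ x ℕ.* b                               ≡⟨ cong₂ (λ b y → y ℕ.* a ℕ.+ x ℕ.* b) (ℕ.m+[n∸m]≡n a≤b) (ℕ.m+[n∸m]≡n x≤y) ⟨
  (x ℕ.+ v) ℕ.* a ℕ.+ x ℕ.* (a ℕ.+ u)               ≤⟨ ℕ.m≤m+n _ (v ℕ.* u) ⟩
  (x ℕ.+ v) ℕ.* a ℕ.+ x ℕ.* (a ℕ.+ u) ℕ.+ v ℕ.* u   ≡⟨ identity x v a u ⟩
  (x ℕ.+ v) ℕ.* (a ℕ.+ u) ℕ.+ x ℕ.* a               ≡⟨ cong₂ (λ b y → y ℕ.* b ℕ.+ x ℕ.* a) (ℕ.m+[n∸m]≡n a≤b) (ℕ.m+[n∸m]≡n x≤y) ⟩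
  y ℕ.* b ℕ.+ x ℕ.* a                               ∎
  where
  open ℕ.≤-Reasoning
  u = b ℕ.∸ a
  v = y ℕ.∸ x
  identity : ∀ x v a u → (x ℕ.+ v) ℕ.* a ℕ.+ x ℕ.* (a ℕ.+ u) ℕ.+ v ℕ.* u ≡ (x ℕ.+ v) ℕ.* (a ℕ.+ u) ℕ.+ x ℕ.* a
  identity = ℕ-Solver.solve-∀

-- At `q = k` the value `q² + C q` already exceeds the constant, by `k (k - 1) + k² j (j + 1)`.
p≤d*k : ∀ j {p d} → p ℕ.* p ℕ.+ p ℕ.* d ℕ.* coefficient j ℕ.< d ℕ.* d ℕ.* constant j → p ≤ d ℕ.* (2 ℕ.+ j)
p≤d*k j {p} {d} H = ℕ.≮⇒≥ λ dk<p → ℕ.<⇒≱ H (begin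
  d ℕ.* d ℕ.* constant j                  ≤⟨ ℕ.m≤m+n _ _ ⟩
  d ℕ.* d ℕ.* constant j ℕ.+ d ℕ.* d ℕ.* ((2 ℕ.+ j) ℕ.* (1 ℕ.+ j) ℕ.+ (2 ℕ.+ j) ℕ.* (2 ℕ.+ j) ℕ.* j ℕ.* (1 ℕ.+ j)) ≡⟨ identity d j ⟩
  d ℕ.* (2 ℕ.+ j) ℕ.* (d ℕ.* (2 ℕ.+ j)) ℕ.+ d ℕ.* (2 ℕ.+ j) ℕ.* d ℕ.* coefficient j ≤⟨ ℕ.+-mono-≤ (ℕ.*-mono-≤ (ℕ.<⇒≤ dk<p) (ℕ.<⇒≤ dk<p)) (ℕ.*-monoˡ-≤ (coefficient j) (ℕ.*-monoˡ-≤ d (ℕ.<⇒≤ dk<p))) ⟩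
  p ℕ.* p ℕ.+ p ℕ.* d ℕ.* coefficient j   ∎)
  where
  open ℕ.≤-Reasoning
  identity : ∀ d j → d ℕ.* d ℕ.* (2 ℕ.* (2 ℕ.+ j) ℕ.* (2 ℕ.+ j) ℕ.* j ℕ.+ (2 ℕ.+ j)) ℕ.+ d ℕ.* d ℕ.* ((2 ℕ.+ j) ℕ.* (1 ℕ.+ j) ℕ.+ (2 ℕ.+ j) ℕ.* (2 ℕ.+ j) ℕ.* j ℕ.* (1 ℕ.+ j))
    ≡ d ℕ.* (2 ℕ.+ j) ℕ.* (d ℕ.* (2 ℕ.+ j)) ℕ.+ d ℕ.* (2 ℕ.+ j) ℕ.* d ℕ.* ((2 ℕ.+ j) ℕ.* j ℕ.* (3 ℕ.+ j))
  identity = ℕ-Solver.solve-∀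

-- The part of the combination below that is free of `M`, `X` and `h`. The first summand comes from
-- rounding `h` down, which costs `j`; the second is `p ((k - 1)² - j)` and combines that loss with
-- the rounding up of the number of bins.
slack : ℕ → ℕ → ℕ → ℕ
slack j p d = d ℕ.* (1 ℕ.+ j) ℕ.* (d ℕ.* (2 ℕ.+ j) ℕ.* j ℕ.+ p ℕ.* (j ℕ.* j ℕ.+ j ℕ.+ 1))

-- After multiplication by d (k - 1)², a nonnegative combination of the four hypotheses and of
-- p ≤ d k; the slack absorbs the rounding errors in h and in the number of bins.
largeHuge-inequality : ∀ j p d .{{_ : ℕ.NonZero d}} M X h →
  p ℕ.* p ℕ.+ p ℕ.* d ℕ.* coefficient j ℕ.< d ℕ.* d ℕ.* constant j →
  slack j p d ℕ.< M →
  M ℕ.* (1 ℕ.+ j) ≤ (1 ℕ.+ j) ℕ.* h ℕ.+ j ℕ.+ X →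
  M ℕ.* (d ℕ.* (2 ℕ.+ j)) ≤ p ℕ.* M ℕ.+ d ℕ.* (1 ℕ.+ j) ℕ.* X →
  p ℕ.* (M ℕ.* (1 ℕ.+ j) ℕ.+ h ℕ.+ (1 ℕ.+ j)) ℕ.< d ℕ.* (2 ℕ.+ j) ℕ.* (X ℕ.+ h)
largeHuge-inequality j p d M X h H slack<M A B = ℕ.*-cancelˡ-< (d ℕ.* k₁ ℕ.* k₁) _ _ (ℕ.+-cancelʳ-< rest (d ℕ.* k₁ ℕ.* k₁ ℕ.* lhs) (d ℕ.* k₁ ℕ.* k₁ ℕ.* rhs) (begin-strict
  d ℕ.* k₁ ℕ.* k₁ ℕ.* lhs ℕ.+ rest   <⟨ ℕ.+-monoʳ-< (d ℕ.* k₁ ℕ.* k₁ ℕ.* lhs) summed ⟩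
  d ℕ.* k₁ ℕ.* k₁ ℕ.* lhs ℕ.+ (d ℕ.* k₁ ℕ.* (d ℕ.* k ℕ.* a ℕ.+ p ℕ.* N) ℕ.+ c ℕ.* b ℕ.+ M ℕ.* E) ≡⟨ identity j p d M X h ⟨
  d ℕ.* k₁ ℕ.* k₁ ℕ.* rhs ℕ.+ rest   ∎))
  where
  open ℕ.≤-Reasoning
  k = 2 ℕ.+ j
  k₁ = 1 ℕ.+ j
  N = M ℕ.* k₁
  a = k₁ ℕ.* h ℕ.+ j ℕ.+ X
  b = p ℕ.* M ℕ.+ d ℕ.* k₁ ℕ.* X
  -- This multiplier of `B` makes the terms in `X` cancel; what remains of the terms in `M` is
  -- exactly `E - F`.
  c = d ℕ.* k ℕ.* j ℕ.+ p
  F = p ℕ.* p ℕ.+ p ℕ.* d ℕ.* coefficient j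
  E = d ℕ.* d ℕ.* constant j
  lhs = p ℕ.* (N ℕ.+ h ℕ.+ k₁)
  rhs = d ℕ.* k ℕ.* (X ℕ.+ h)
  rest = d ℕ.* k₁ ℕ.* (d ℕ.* k ℕ.* N ℕ.+ p ℕ.* a) ℕ.+ c ℕ.* (M ℕ.* (d ℕ.* k)) ℕ.+ M ℕ.* F ℕ.+ slack j p d
  instance
    dk₁k₁≢0 : ℕ.NonZero (d ℕ.* k₁ ℕ.* k₁)
    dk₁k₁≢0 = ℕ.m*n≢0 (d ℕ.* k₁) k₁ {{ℕ.m*n≢0 d k₁}}
  MF+slack< : M ℕ.* F ℕ.+ slack j p d ℕ.< M ℕ.* E
  MF+slack< = begin-strict
    M ℕ.* F ℕ.+ slack j p d   <⟨ ℕ.+-monoʳ-< (M ℕ.* F) slack<M ⟩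
    M ℕ.* F ℕ.+ M             ≡⟨ ℕ.+-comm (M ℕ.* F) M ⟩
    M ℕ.+ M ℕ.* F             ≡⟨ ℕ.*-suc M F ⟨
    M ℕ.* suc F               ≤⟨ ℕ.*-monoʳ-≤ M H ⟩
    M ℕ.* E                   ∎
  summed : rest ℕ.< d ℕ.* k₁ ℕ.* (d ℕ.* k ℕ.* a ℕ.+ p ℕ.* N) ℕ.+ c ℕ.* b ℕ.+ M ℕ.* E
  summed = begin-strict
    rest ≡⟨ ℕ.+-assoc (d ℕ.* k₁ ℕ.* (d ℕ.* k ℕ.* N ℕ.+ p ℕ.* a) ℕ.+ c ℕ.* (M ℕ.* (d ℕ.* k))) (M ℕ.* F) (slack j p d) ⟩
    d ℕ.* k₁ ℕ.* (d ℕ.* k ℕ.* N ℕ.+ p ℕ.* a) ℕ.+ c ℕ.* (M ℕ.* (d ℕ.* k)) ℕ.+ (M ℕ.* F ℕ.+ slack j p d)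
      -- Here `rearrangement` multiplies `N ≤ a` by the nonnegative number `d k - p`.
      <⟨ ℕ.+-mono-≤-< (ℕ.+-mono-≤ (ℕ.*-monoʳ-≤ (d ℕ.* k₁) (rearrangement A (p≤d*k j {p} {d} H))) (ℕ.*-monoʳ-≤ c B)) MF+slack< ⟩
    d ℕ.* k₁ ℕ.* (d ℕ.* k ℕ.* a ℕ.+ p ℕ.* N) ℕ.+ c ℕ.* b ℕ.+ M ℕ.* E ∎
  identity : ∀ j p d M X h →
    d ℕ.* (1 ℕ.+ j) ℕ.* (1 ℕ.+ j) ℕ.* (d ℕ.* (2 ℕ.+ j) ℕ.* (X ℕ.+ h)) ℕ.+ (d ℕ.* (1 ℕ.+ j) ℕ.* (d ℕ.* (2 ℕ.+ j) ℕ.* (M ℕ.* (1 ℕ.+ j)) ℕ.+ p ℕ.* ((1 ℕ.+ j) ℕ.* h ℕ.+ j ℕ.+ X)) ℕ.+ (d ℕ.* (2 ℕ.+ j) ℕ.* j ℕ.+ p) ℕ.* (M ℕ.* (d ℕ.* (2 ℕ.+ j))) ℕ.+ M ℕ.* (p ℕ.* p ℕ.+ p ℕ.* d ℕ.* ((2 ℕ.+ j) ℕ.* j ℕ.* (3 ℕ.+ j))) ℕ.+ d ℕ.* (1 ℕ.+ j) ℕ.* (d ℕ.* (2 ℕ.+ j) ℕ.* j ℕ.+ p ℕ.* (j ℕ.* j ℕ.+ j ℕ.+ 1)))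
    ≡ d ℕ.* (1 ℕ.+ j) ℕ.* (1 ℕ.+ j) ℕ.* (p ℕ.* (M ℕ.* (1 ℕ.+ j) ℕ.+ h ℕ.+ (1 ℕ.+ j))) ℕ.+ (d ℕ.* (1 ℕ.+ j) ℕ.* (d ℕ.* (2 ℕ.+ j) ℕ.* ((1 ℕ.+ j) ℕ.* h ℕ.+ j ℕ.+ X) ℕ.+ p ℕ.* (M ℕ.* (1 ℕ.+ j))) ℕ.+ (d ℕ.* (2 ℕ.+ j) ℕ.* j ℕ.+ p) ℕ.* (p ℕ.* M ℕ.+ d ℕ.* (1 ℕ.+ j) ℕ.* X) ℕ.+ M ℕ.* (d ℕ.* d ℕ.* (2 ℕ.* (2 ℕ.+ j) ℕ.* (2 ℕ.+ j) ℕ.* j ℕ.+ (2 ℕ.+ j))))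
  identity = ℕ-Solver.solve-∀

-- Runs of an online algorithm: invariants of bins and numbers of items.

private variable
  k : ℕ
  x y : ℚ
  bins : List Bin

run-++ : ∀ (A : OnlineAlg k) hist bins xs ys →
  run A hist bins (xs ++ ys) ≡ run A (hist ++ xs) (run A hist bins xs) ys
run-++ A hist bins [] ys = cong (λ hist → run A hist bins ys) (sym (++-identityʳ hist))
run-++ A hist bins (x ∷ xs) ys = trans (run-++ A (hist ++ [ x ]) _ xs ys)
  (cong (λ hist → run A hist (run A _ (place bins x (A _ bins x)) xs) ys) (++-assoc hist [ x ] xs))

All-updateAt : ∀ {P : Pred Bin 0ℓ} {f} (i : Fin (length bins)) → All P bins →
  (P (lookup bins i) → P (f (lookup bins i))) → All P (updateAt bins i f)
All-updateAt {bins = _ ∷ _} zero    (p ∷ ps) g = g p ∷ ps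
All-updateAt {bins = _ ∷ _} (suc i) (p ∷ ps) g = p ∷ All-updateAt i ps g

Preserved : ℕ → Pred Bin 0ℓ → Pred ℚ 0ℓ
Preserved k P x = P [ x ] × (∀ {b} → Fits k b x → P b → P (x ∷ b))

place-All : ∀ {P} (c : Choice k bins x) → Preserved k P x → All P bins → All P (place bins x c)
place-All (inj₁ _)          (single , _)   ps = All.++⁺ ps (single ∷ [])
place-All (inj₂ (i , fits)) (_ , extended) ps = All-updateAt i ps (extended fits)

run-All : ∀ {P} (A : OnlineAlg k) hist {bins xs} → All (Preserved k P) xs → All P bins →
  All P (run A hist bins xs)
run-All A hist []         ps = ps
run-All A hist {bins} {x ∷ _} (pres ∷ press) ps = run-All A (hist ++ [ x ]) press (place-All (A hist bins x) pres ps)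

length-concat-updateAt : ∀ (bins : List Bin) i x →
  length (concat (updateAt bins i (x ∷_))) ≡ suc (length (concat bins))
length-concat-updateAt (b ∷ bins) zero    x = refl
length-concat-updateAt (b ∷ bins) (suc i) x = begin
  length (b ++ concat (updateAt bins i (x ∷_)))           ≡⟨ length-++ b ⟩
  length b ℕ.+ length (concat (updateAt bins i (x ∷_)))   ≡⟨ cong (length b ℕ.+_) (length-concat-updateAt bins i x) ⟩
  length b ℕ.+ suc (length (concat bins))                 ≡⟨ ℕ.+-suc (length b) _ ⟩
  suc (length b ℕ.+ length (concat bins))                 ≡⟨ cong suc (length-++ b) ⟨
  suc (length (b ++ concat bins))                         ∎
  where open ≡-Reasoning

length-concat-place : ∀ bins x (c : Choice k bins x) → length (concat (place bins x c)) ≡ suc (length (concat bins))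
length-concat-place bins x (inj₁ _) = begin
  length (concat (bins ++ [ x ] ∷ []))   ≡⟨ cong length (concat-++ bins ([ x ] ∷ [])) ⟨
  length (concat bins ++ [ x ])          ≡⟨ length-++ (concat bins) ⟩
  length (concat bins) ℕ.+ 1             ≡⟨ ℕ.+-comm _ 1 ⟩
  suc (length (concat bins))             ∎
  where open ≡-Reasoning
length-concat-place bins x (inj₂ (i , _)) = length-concat-updateAt bins i x

length-concat-run : ∀ (A : OnlineAlg k) hist bins xs →
  length (concat (run A hist bins xs)) ≡ length xs ℕ.+ length (concat bins)
length-concat-run A hist bins []       = refl
length-concat-run A hist bins (x ∷ xs) = begin
  length (concat (run A (hist ++ [ x ]) (place bins x c) xs))   ≡⟨ length-concat-run A _ _ xs ⟩
  length xs ℕ.+ length (concat (place bins x c))                ≡⟨ cong (length xs ℕ.+_) (length-concat-place bins x c) ⟩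
  length xs ℕ.+ suc (length (concat bins))                      ≡⟨ ℕ.+-suc (length xs) _ ⟩
  suc (length xs ℕ.+ length (concat bins))                      ∎
  where
  open ≡-Reasoning
  c = A hist bins x

length-concat-≤ : ∀ {P : List Bin} → All (λ b → length b ≤ k) P → length (concat P) ≤ length P ℕ.* k
length-concat-≤ []                     = z≤n
length-concat-≤ {P = b ∷ P} (b≤k ∷ ≤k) =
  ℕ.≤-trans (ℕ.≤-reflexive (length-++ b)) (ℕ.+-mono-≤ b≤k (length-concat-≤ ≤k))

-- Bins that cannot take a given item.

Fits? : ∀ k b x → Dec (Fits k b x)
Fits? k b x = (length b ℕ.<? k) ×-dec (sumℚ b + x ℚ.≤? 1ℚ)

Blocked? : ∀ k x b → Dec (¬ Fits k b x)
Blocked? k x b = ¬? (Fits? k b x)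

blocked : ℕ → ℚ → List Bin → ℕ
blocked k x bins = length (filter (Blocked? k x) bins)

blocked-yes : ∀ b bins → ¬ Fits k b x → blocked k x (b ∷ bins) ≡ suc (blocked k x bins)
blocked-yes {k} {x} b bins ¬fits = cong length (filter-accept (Blocked? k x) ¬fits)

blocked-no : ∀ b bins → Fits k b x → blocked k x (b ∷ bins) ≡ blocked k x bins
blocked-no {k} {x} b bins fits = cong length (filter-reject (Blocked? k x) (λ ¬fits → ¬fits fits))

-- A bin that still accepts `x` has a free place and so holds at most `k₁` items; only a blocked bin
-- can hold one more. Hence many items in few bins force many blocked bins.
length-concat-≤-blocked : ∀ {k₁} x → All (λ b → length b ≤ suc k₁) bins →
  length (concat bins) ≤ k₁ ℕ.* length bins ℕ.+ blocked (suc k₁) x bins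
length-concat-≤-blocked x [] = z≤n
length-concat-≤-blocked {b ∷ bins} {k₁} x (b≤k ∷ ≤k) = begin
  length (b ++ concat bins)                                     ≡⟨ length-++ b ⟩
  length b ℕ.+ length (concat bins)                             ≤⟨ bound (Fits? (suc k₁) b x) ⟩
  k₁ ℕ.+ k₁ ℕ.* length bins ℕ.+ blocked (suc k₁) x (b ∷ bins)   ≡⟨ cong (ℕ._+ blocked (suc k₁) x (b ∷ bins)) (ℕ.*-suc k₁ (length bins)) ⟨
  k₁ ℕ.* suc (length bins) ℕ.+ blocked (suc k₁) x (b ∷ bins)    ∎
  where
  open ℕ.≤-Reasoning
  rest = length-concat-≤-blocked x ≤k
  bound : Dec (Fits (suc k₁) b x) →
    length b ℕ.+ length (concat bins) ≤ k₁ ℕ.+ k₁ ℕ.* length bins ℕ.+ blocked (suc k₁) x (b ∷ bins)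
  bound (yes fits@(s≤s b≤k₁ , _)) = begin
    length b ℕ.+ length (concat bins)                             ≤⟨ ℕ.+-mono-≤ b≤k₁ rest ⟩
    k₁ ℕ.+ (k₁ ℕ.* length bins ℕ.+ blocked (suc k₁) x bins)       ≡⟨ ℕ.+-assoc k₁ _ _ ⟨
    k₁ ℕ.+ k₁ ℕ.* length bins ℕ.+ blocked (suc k₁) x bins         ≡⟨ cong (k₁ ℕ.+ k₁ ℕ.* length bins ℕ.+_) (blocked-no b bins fits) ⟨
    k₁ ℕ.+ k₁ ℕ.* length bins ℕ.+ blocked (suc k₁) x (b ∷ bins)   ∎
  bound (no ¬fits) = begin
    length b ℕ.+ length (concat bins)                               ≤⟨ ℕ.+-mono-≤ b≤k rest ⟩
    suc (k₁ ℕ.+ (k₁ ℕ.* length bins ℕ.+ blocked (suc k₁) x bins))   ≡⟨ cong suc (ℕ.+-assoc k₁ _ _) ⟨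
    suc (k₁ ℕ.+ k₁ ℕ.* length bins ℕ.+ blocked (suc k₁) x bins)     ≡⟨ ℕ.+-suc _ _ ⟨
    k₁ ℕ.+ k₁ ℕ.* length bins ℕ.+ suc (blocked (suc k₁) x bins)     ≡⟨ cong (k₁ ℕ.+ k₁ ℕ.* length bins ℕ.+_) (blocked-yes b bins ¬fits) ⟨
    k₁ ℕ.+ k₁ ℕ.* length bins ℕ.+ blocked (suc k₁) x (b ∷ bins)     ∎

NonNegSum : Pred Bin 0ℓ
NonNegSum b = 0ℚ ℚ.≤ sumℚ b

-- Placing an item larger than 1/2 blocks its bin, which was not blocked before.
module _ (1<y+y : 1ℚ < y + y) where

  own-bin-blocked : ∀ b → NonNegSum b → ¬ Fits k (y ∷ b) y
  own-bin-blocked b 0≤b (_ , y+b+y≤1) = <⇒≱ 1<y+y (begin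
    y + y            ≡⟨ cong (_+ y) (+-identityʳ y) ⟨
    y + 0ℚ + y       ≤⟨ +-monoˡ-≤ y (+-monoʳ-≤ y 0≤b) ⟩
    y + sumℚ b + y   ≤⟨ y+b+y≤1 ⟩
    1ℚ               ∎)
    where open ≤-Reasoning

  blocked-updateAt : ∀ bins i → Fits k (lookup bins i) y → All NonNegSum bins →
    blocked k y (updateAt bins i (y ∷_)) ≡ suc (blocked k y bins)
  blocked-updateAt {k} (b ∷ bins) zero fits (0≤b ∷ _) = begin
    blocked k y ((y ∷ b) ∷ bins)   ≡⟨ blocked-yes (y ∷ b) bins (own-bin-blocked b 0≤b) ⟩
    suc (blocked k y bins)         ≡⟨ cong suc (blocked-no b bins fits) ⟨
    suc (blocked k y (b ∷ bins))   ∎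
    where open ≡-Reasoning
  blocked-updateAt {k} (b ∷ bins) (suc i) fits (_ ∷ 0≤) = extend (Fits? k b y)
    where
    rest = blocked-updateAt bins i fits 0≤
    extend : Dec (Fits k b y) →
      blocked k y (b ∷ updateAt bins i (y ∷_)) ≡ suc (blocked k y (b ∷ bins))
    extend (yes fits) = trans (blocked-no b (updateAt bins i (y ∷_)) fits) (trans rest (cong suc (sym (blocked-no b bins fits))))
    extend (no ¬fits) = trans (blocked-yes b (updateAt bins i (y ∷_)) ¬fits) (trans (cong suc rest) (cong suc (sym (blocked-yes b bins ¬fits))))

  blocked-place : ∀ bins (c : Choice k bins y) → All NonNegSum bins →
    blocked k y (place bins y c) ≡ suc (blocked k y bins)
  blocked-place {k} bins (inj₁ _) _ = begin
    blocked k y (bins ++ [ y ] ∷ [])                ≡⟨ cong length (filter-++ (Blocked? k y) bins ([ y ] ∷ [])) ⟩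
    length (filter (Blocked? k y) bins ++ filter (Blocked? k y) ([ y ] ∷ [])) ≡⟨ length-++ (filter (Blocked? k y) bins) ⟩
    blocked k y bins ℕ.+ blocked k y ([ y ] ∷ [])   ≡⟨ cong (blocked k y bins ℕ.+_) (blocked-yes {k} [ y ] [] (own-bin-blocked [] ≤-refl)) ⟩
    blocked k y bins ℕ.+ 1                          ≡⟨ ℕ.+-comm _ 1 ⟩
    suc (blocked k y bins)                          ∎
    where open ≡-Reasoning
  blocked-place bins (inj₂ (i , fits)) 0≤ = blocked-updateAt bins i fits 0≤

0<⇒NonNegSum-preserved : 0ℚ < x → Preserved k NonNegSum x
0<⇒NonNegSum-preserved {x} 0<x = grow {[]} ≤-refl , λ {b} _ → grow {b}
  where
  grow : ∀ {b} → NonNegSum b → NonNegSum (x ∷ b)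
  grow 0≤b = ≤-trans (≤-reflexive (sym (+-identityˡ 0ℚ))) (+-mono-≤ (<⇒≤ 0<x) 0≤b)

length≤-preserved : 1 ≤ k → Preserved k (λ b → length b ≤ k) x
length≤-preserved 1≤k = 1≤k , λ (b<k , _) _ → b<k

-- Counting blocked bins makes the choices of the algorithm irrelevant: opening a bin and using an
-- old one both raise the count by one. The final count is a lower bound for the cost.
blocked-run : ∀ (A : OnlineAlg k) hist bins h → 1ℚ < y + y → 0ℚ < y → All NonNegSum bins →
  blocked k y (run A hist bins (replicate h y)) ≡ h ℕ.+ blocked k y bins
blocked-run A hist bins zero    _ _ _ = refl
blocked-run {k} {y} A hist bins (suc h) 1<y+y 0<y 0≤ = begin
  blocked k y (run A (hist ++ [ y ]) (place bins y c) (replicate h y))   ≡⟨ blocked-run A _ _ h 1<y+y 0<y (place-All c (0<⇒NonNegSum-preserved 0<y) 0≤) ⟩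
  h ℕ.+ blocked k y (place bins y c)                                     ≡⟨ cong (h ℕ.+_) (blocked-place 1<y+y bins c 0≤) ⟩
  h ℕ.+ suc (blocked k y bins)                                           ≡⟨ ℕ.+-suc h _ ⟩
  suc h ℕ.+ blocked k y bins                                             ∎
  where
  open ≡-Reasoning
  c = A hist bins y

-- Sizes as multiples of `1 / T`, and the gaps between them.

module Scaled (T : ℕ) .{{T≢0 : ℕ.NonZero T}} where

  private instance
    T>0 : ℚ.Positive (ℕtoℚ T)
    T>0 = ℕtoℚ-positive T

    T≢0ℚ : ℚ.NonZero (ℕtoℚ T)
    T≢0ℚ = pos⇒nonZero (ℕtoℚ T)

    1/T>0 : ℚ.Positive (1/ ℕtoℚ T)
    1/T>0 = 1/pos⇒pos (ℕtoℚ T)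

  σ : ℕ → ℚ
  σ s = ℕtoℚ s * 1/ ℕtoℚ T

  σ-T : σ T ≡ 1ℚ
  σ-T = *-inverseʳ (ℕtoℚ T)

  σ-0 : σ 0 ≡ 0ℚ
  σ-0 = *-zeroˡ (1/ ℕtoℚ T)

  σ-+ : ∀ a b → σ (a ℕ.+ b) ≡ σ a + σ b
  σ-+ a b = trans (cong (_* 1/ ℕtoℚ T) (ℕtoℚ-+ a b)) (*-distribʳ-+ (1/ ℕtoℚ T) (ℕtoℚ a) (ℕtoℚ b))

  σ-mono-≤ : ∀ {a b} → a ≤ b → σ a ℚ.≤ σ b
  σ-mono-≤ a≤b = *-monoʳ-≤-nonNeg (1/ ℕtoℚ T) {{pos⇒nonNeg (1/ ℕtoℚ T)}} (ℕtoℚ-mono-≤ a≤b)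

  σ-mono-< : ∀ {a b} → a ℕ.< b → σ a < σ b
  σ-mono-< a<b = *-monoˡ-<-pos (1/ ℕtoℚ T) (ℕtoℚ-mono-< a<b)

  σ≤1 : ∀ {a} → a ≤ T → σ a ℚ.≤ 1ℚ
  σ≤1 a≤T = ≤-trans (σ-mono-≤ a≤T) (≤-reflexive σ-T)

  1<σ : ∀ {a} → T ℕ.< a → 1ℚ < σ a
  1<σ T<a = ≤-<-trans (≤-reflexive (sym σ-T)) (σ-mono-< T<a)

  0<σ : ∀ {a} → 0 ℕ.< a → 0ℚ < σ a
  0<σ 0<a = ≤-<-trans (≤-reflexive (sym σ-0)) (σ-mono-< 0<a)

  sumℚ-≤ : ∀ {c n b} → length b ≤ n → All (ℚ._≤ σ c) b → sumℚ b ℚ.≤ σ (n ℕ.* c)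
  sumℚ-≤ {c} {n}     _         []       = ≤-trans (≤-reflexive (sym σ-0)) (σ-mono-≤ {0} {n ℕ.* c} z≤n)
  sumℚ-≤ {c} {suc n} {x ∷ b} (s≤s b≤n) (x≤ ∷ ≤c) = begin
    x + sumℚ b          ≤⟨ +-mono-≤ x≤ (sumℚ-≤ b≤n ≤c) ⟩
    σ c + σ (n ℕ.* c)   ≡⟨ σ-+ c (n ℕ.* c) ⟨
    σ (c ℕ.+ n ℕ.* c)   ∎
    where open ≤-Reasoning

-- In closed form `k ^ (2 ^ n)`. With `n` items to come this is the ratio kept free between small
-- and large sizes: squaring leaves room for an item in the geometric middle, and a factor `k`
-- survives at the end.
gap : ℕ → ℕ → ℕ
gap k zero    = k
gap k (suc n) = gap k n ℕ.* gap k n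

gap-positive : ∀ n → 1 ≤ k → 1 ≤ gap k n
gap-positive zero    1≤k = 1≤k
gap-positive (suc n) 1≤k = ℕ.*-mono-≤ (gap-positive n 1≤k) (gap-positive n 1≤k)

-- Lengths of blocks and division with remainder.

take-length : ∀ n (xs : List ℚ) → length (take n xs) ≤ n
take-length n xs = ℕ.≤-trans (ℕ.≤-reflexive (length-take n xs)) (ℕ.m⊓n≤m n (length xs))

take-length-≡ : ∀ {n} {xs : List ℚ} → n ≤ length xs → length (take n xs) ≡ n
take-length-≡ {n} {xs} n≤ = trans (length-take n xs) (ℕ.m≤n⇒m⊓n≡m n≤)

drop-length-≤ : ∀ m {n} (xs : List ℚ) → length xs ≤ m ℕ.+ n → length (drop m xs) ≤ n
drop-length-≤ m {n} xs xs≤ = begin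
  length (drop m xs)   ≡⟨ length-drop m xs ⟩
  length xs ℕ.∸ m      ≤⟨ ℕ.∸-monoˡ-≤ m xs≤ ⟩
  m ℕ.+ n ℕ.∸ m        ≡⟨ ℕ.m+n∸m≡n m n ⟩
  n                    ∎
  where open ℕ.≤-Reasoning

m<[1+m/n]*n : ∀ m n .{{_ : ℕ.NonZero n}} → m ℕ.< suc (m ℕ./ n) ℕ.* n
m<[1+m/n]*n m n = begin-strict
  m                           ≡⟨ ℕ.m≡m%n+[m/n]*n m n ⟩
  m ℕ.% n ℕ.+ m ℕ./ n ℕ.* n   <⟨ ℕ.+-monoˡ-< (m ℕ./ n ℕ.* n) (ℕ.m%n<n m n) ⟩
  suc (m ℕ./ n) ℕ.* n         ∎
  where open ℕ.≤-Reasoning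

-- Inputs that refute a ratio.

Refutes : ∀ {k} → OnlineAlg k → ℚ → ℕ → Set
Refutes {k} A q K = Σ (List ℚ) λ L → All ValidItem L × ∃ λ m →
  IsOPT k L m × K ≤ m × q * ℕtoℚ m < ℕtoℚ (cost A L)

refutes : ∀ q {p} → ℚ.↥ q ≡ + p → ∀ (A : OnlineAlg k) {K L m n} →
  All ValidItem L × IsOPT k L m × n ≤ cost A L →
  K ≤ m → p ℕ.* m ℕ.< ℚ.↧ₙ q ℕ.* n → Refutes A q K
refutes q ↥q≡p A {L = L} {m} (valid , opt , n≤cost) K≤m pm<dn =
  L , valid , m , opt , K≤m , q*m<n q ↥q≡p (ℕ.<-≤-trans pm<dn (ℕ.*-monoʳ-≤ (ℚ.↧ₙ q) n≤cost))

refutes-mono : ∀ {q q′} → q ℚ.≤ q′ → ∀ (A : OnlineAlg k) {K} → Refutes A q′ K → Refutes A q K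
refutes-mono q≤q′ A (L , valid , m , opt , K≤m , q′m<cost) = L , valid , m , opt , K≤m ,
  ≤-<-trans (*-monoʳ-≤-nonNeg (ℕtoℚ m) {{ℚ.nonNegative (ℕtoℚ-mono-≤ {0} {m} z≤n)}} q≤q′) q′m<cost

-- Packings for the optimum, and the two phases of the game.

module Game (T : ℕ) .{{T≢0 : ℕ.NonZero T}} where
  open Scaled T

  Within : ℕ → Pred ℚ 0ℓ
  Within c x = 0ℚ < x × x ℚ.≤ σ c

  within-weaken : ∀ {c c′} → c ≤ c′ → Within c x → Within c′ x
  within-weaken c≤c′ (0<x , x≤c) = 0<x , ≤-trans x≤c (σ-mono-≤ c≤c′)

  -- Consecutive blocks will do, because any `k` items of size at most `σ c` fit together.
  pack : ∀ {c} n R → length R ≤ n ℕ.* k → k ℕ.* c ≤ T → All (Within c) R →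
    ∃ λ P → concat P ≡ R × All (BinOK k) P × length P ≡ n
  pack zero    []      _  _    _  = [] , refl , [] , refl
  pack {k} (suc n) R R≤ kc≤T ok with pack n (drop k R) (drop-length-≤ k R R≤) kc≤T (All.drop⁺ k ok)
  ... | P , concat≡ , P-ok , lengthP =
    take k R ∷ P ,
    trans (cong (take k R ++_) concat≡) (take++drop≡id k R) ,
    (take-length k R , ≤-trans (sumℚ-≤ (take-length k R) (All.map proj₂ (All.take⁺ k ok))) (σ≤1 kc≤T)) ∷ P-ok ,
    cong suc lengthP

  -- Each bin takes one huge item and the next block of `k₁` items of `S`.
  packHuge : ∀ {k₁ c Y} h S → length S ≡ h ℕ.* k₁ → k₁ ℕ.* c ℕ.+ Y ≤ T → All (Within c) S →
    ∃ λ P → concat P ↭ replicate h (σ Y) ++ S × All (BinOK (suc k₁)) P × length P ≡ h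
  packHuge zero    []      _  _    _  = [] , ↭-refl , [] , refl
  packHuge {k₁} {c} {Y} (suc h) S S≡ ≤T ok
    with packHuge h (drop k₁ S) (trans (length-drop k₁ S) (trans (cong (ℕ._∸ k₁) S≡) (ℕ.m+n∸m≡n k₁ _))) ≤T (All.drop⁺ k₁ ok)
  ... | P , concat↭ , P-ok , lengthP =
    (σ Y ∷ take k₁ S) ∷ P , prep (σ Y) rest ,
    (s≤s (take-length k₁ S) , sum≤1) ∷ P-ok , cong suc lengthP
    where
    hs = replicate h (σ Y)
    rest : take k₁ S ++ concat P ↭ hs ++ S
    rest = begin
      take k₁ S ++ concat P          ↭⟨ ↭.++⁺ˡ (take k₁ S) concat↭ ⟩
      take k₁ S ++ hs ++ drop k₁ S   ↭⟨ ↭.shifts (take k₁ S) hs ⟩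
      hs ++ take k₁ S ++ drop k₁ S   ≡⟨ cong (hs ++_) (take++drop≡id k₁ S) ⟩
      hs ++ S                        ∎
      where open PermutationReasoning
    sum≤1 : sumℚ (σ Y ∷ take k₁ S) ℚ.≤ 1ℚ
    sum≤1 = begin
      σ Y + sumℚ (take k₁ S)   ≤⟨ +-monoʳ-≤ (σ Y) (sumℚ-≤ (take-length k₁ S) (All.map proj₂ (All.take⁺ k₁ ok))) ⟩
      σ Y + σ (k₁ ℕ.* c)       ≡⟨ +-comm (σ Y) (σ (k₁ ℕ.* c)) ⟩
      σ (k₁ ℕ.* c) + σ Y       ≡⟨ σ-+ (k₁ ℕ.* c) Y ⟨
      σ (k₁ ℕ.* c ℕ.+ Y)       ≤⟨ σ≤1 ≤T ⟩
      1ℚ                       ∎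
      where open ≤-Reasoning

  -- The threshold `cap` is known only after all choices of the algorithm. It separates two loads:
  -- `k - 1` small items leave room for an item of size `T - (k - 1) cap`, whereas by `heavy` no bin
  -- of the algorithm does.
  record TinyPhase (A : OnlineAlg k) (hist : List ℚ) (bins : List Bin) (n lo top : ℕ) : Set where
    field
      items smalls larges : List ℚ
      cap       : ℕ
      final     : List Bin
      reached   : run A hist bins items ≡ final
      partition : items ↭ smalls ++ larges
      count     : length items ≡ n
      lo≤cap    : lo ≤ cap
      cap≤top   : cap ≤ top
      smalls≤   : All (Within cap) smalls
      larges≤   : All (Within top) larges
      opened    : length final ≡ length bins ℕ.+ length larges
      heavy     : All (λ b → σ (cap ℕ.* k) ℚ.≤ sumℚ b) final

  -- lo bounds the small items so far and lo * gap n the large ones from below; the next item has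
  -- size lo * gap (n - 1), far from both, and becomes large exactly when it opens a bin.
  tinyPhase : ∀ (A : OnlineAlg k) hist bins n lo → 1 ≤ k → 1 ≤ lo →
    All (λ b → σ (lo ℕ.* gap k n) ℚ.≤ sumℚ b) bins →
    TinyPhase A hist bins n lo (lo ℕ.* gap k n)
  -- With no items left the gap is `k`, so `cap = lo` turns the hypothesis on the bins into the
  -- field `heavy`.
  tinyPhase {k} A hist bins zero lo 1≤k 1≤lo heavy = record
    { items = [] ; smalls = [] ; larges = [] ; cap = lo ; final = bins
    ; reached = refl ; partition = ↭-refl ; count = refl
    ; lo≤cap = ℕ.≤-refl ; cap≤top = ℕ.m≤m*n lo k {{ℕ.>-nonZero 1≤k}}
    ; smalls≤ = [] ; larges≤ = [] ; opened = sym (ℕ.+-identityʳ _) ; heavy = heavy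
    }
  tinyPhase {k} A hist bins (suc n) lo 1≤k 1≤lo heavy = respond (A hist bins (σ s)) refl
    where
    g = gap k n
    s = lo ℕ.* g
    1≤g : 1 ≤ g
    1≤g = gap-positive n 1≤k
    1≤s : 1 ≤ s
    1≤s = ℕ.*-mono-≤ 1≤lo 1≤g
    s*g≡ : s ℕ.* g ≡ lo ℕ.* (g ℕ.* g)
    s*g≡ = ℕ.*-assoc lo g g
    s≤s*g : s ≤ s ℕ.* g
    s≤s*g = ℕ.m≤m*n s g {{ℕ.>-nonZero 1≤g}}
    s≤lo*gap : s ≤ lo ℕ.* (g ℕ.* g)
    s≤lo*gap = ℕ.≤-trans s≤s*g (ℕ.≤-reflexive s*g≡)
    hist′ = hist ++ [ σ s ]
    respond : (c : Choice k bins (σ s)) → A hist bins (σ s) ≡ c → TinyPhase A hist bins (suc n) lo (lo ℕ.* gap k (suc n))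
    -- The item becomes large: `lo` stays, and the threshold for large sizes drops to `lo * g`, the
    -- size of this very item.
    respond (inj₁ _) A≡ = record
      { items = σ s ∷ items ; smalls = smalls ; larges = σ s ∷ larges ; cap = cap ; final = final
      ; reached = trans (cong (λ c → run A hist′ (place bins (σ s) c) items) A≡) reached
      ; partition = ↭-trans (prep (σ s) partition) (↭-sym (↭.shift (σ s) smalls larges))
      ; count = cong suc count
      ; lo≤cap = lo≤cap ; cap≤top = ℕ.≤-trans cap≤top s≤lo*gap
      ; smalls≤ = smalls≤
      ; larges≤ = (0<σ 1≤s , σ-mono-≤ s≤lo*gap) ∷ All.map (within-weaken s≤lo*gap) larges≤
      ; opened = trans opened (trans (cong (ℕ._+ length larges) (length-++ bins)) (ℕ.+-assoc (length bins) 1 (length larges)))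
      ; heavy = heavy′
      }
      where
      open TinyPhase (tinyPhase A hist′ (bins ++ [ σ s ∷ [] ]) n lo 1≤k 1≤lo
        (All.++⁺ (All.map (≤-trans (σ-mono-≤ s≤lo*gap)) heavy)
                 (≤-reflexive (sym (+-identityʳ (σ s))) ∷ []))) renaming (heavy to heavy′)
    -- The item becomes small: `lo` rises to `s`. As `s * g` equals the old threshold for large
    -- sizes, the old bins stay above it.
    respond (inj₂ (i , fits)) A≡ = record
      { items = σ s ∷ items ; smalls = σ s ∷ smalls ; larges = larges ; cap = cap ; final = final
      ; reached = trans (cong (λ c → run A hist′ (place bins (σ s) c) items) A≡) reached
      ; partition = prep (σ s) partition
      ; count = cong suc count
      ; lo≤cap = ℕ.≤-trans (ℕ.m≤m*n lo g {{ℕ.>-nonZero 1≤g}}) lo≤cap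
      ; cap≤top = subst (cap ≤_) s*g≡ cap≤top
      ; smalls≤ = (0<σ 1≤s , σ-mono-≤ lo≤cap) ∷ smalls≤
      ; larges≤ = subst (λ c → All (Within c) larges) s*g≡ larges≤
      ; opened = trans opened (cong (ℕ._+ length larges) (length-%= bins i (σ s ∷_)))
      ; heavy = heavy′
      }
      where
      grow : σ (lo ℕ.* (g ℕ.* g)) ℚ.≤ sumℚ (lookup bins i) → σ (lo ℕ.* (g ℕ.* g)) ℚ.≤ sumℚ (σ s ∷ lookup bins i)
      grow ≤b = ≤-trans ≤b (≤-trans (≤-reflexive (sym (+-identityˡ _))) (+-monoˡ-≤ (sumℚ (lookup bins i)) (<⇒≤ (0<σ 1≤s))))
      open TinyPhase (tinyPhase A hist′ (updateAt bins i (σ s ∷_)) n s 1≤k 1≤s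
        (subst (λ c → All (λ b → σ c ℚ.≤ sumℚ b) (updateAt bins i (σ s ∷_))) (sym s*g≡)
          (All-updateAt i heavy grow))) renaming (heavy to heavy′)

  -- Common to both continuations. The items `S` accompany the huge ones, `k₁` to a bin, and `R` is
  -- packed `k` to a bin. The bounds on `length R` say that `c` is its quotient by `k`, rounded up,
  -- so at most one bin is not full and counting items shows that the packing is optimal. The huge
  -- items block `h` bins beyond those blocked before.
  attack : ∀ {k₁ cap top Y} (A : OnlineAlg (suc k₁)) L S R h c → let k = suc k₁ ; L′ = L ++ replicate h (σ Y) in
    L ↭ S ++ R → length S ≡ h ℕ.* k₁ → length R ≤ c ℕ.* k → c ℕ.* k ≤ length R ℕ.+ k₁ →
    All (Within cap) S → All (Within top) R → cap ≤ top → k ℕ.* top ≤ T →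
    k₁ ℕ.* cap ℕ.+ Y ≡ T → T ℕ.< Y ℕ.+ Y →
    All ValidItem L′ × IsOPT k L′ (h ℕ.+ c) × h ℕ.+ blocked k (σ Y) (run A [] [] L) ≤ cost A L′
  attack {k₁} {cap} {top} {Y} A L S R h c L↭ lengthS lengthR≤ ck≤ S-ok R-ok cap≤top ktop≤T kcap+Y T<2Y =
    L′-ok , (packing , minimal) , cost≥
    where
    hs = replicate h (σ Y)
    L′ = L ++ hs
    Y≤T : Y ≤ T
    Y≤T = subst (Y ≤_) kcap+Y (ℕ.m≤n+m Y (k₁ ℕ.* cap))
    0<Y : 0 ℕ.< Y
    0<Y = ℕ.≰⇒> λ Y≤0 → ℕ.<⇒≱ T<2Y (ℕ.≤-trans (ℕ.+-mono-≤ Y≤0 Y≤0) z≤n)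
    L-ok : All (Within top) L
    L-ok = ↭.All-resp-↭ (↭-sym L↭) (All.++⁺ (All.map (within-weaken cap≤top) S-ok) R-ok)
    top≤T : top ≤ T
    top≤T = ℕ.≤-trans (ℕ.m≤n*m top (suc k₁)) ktop≤T
    L′-ok : All ValidItem L′
    L′-ok = All.++⁺ (All.map (λ (0<x , x≤) → 0<x , ≤-trans x≤ (σ≤1 top≤T)) L-ok)
                    (All.replicate⁺ h (0<σ 0<Y , σ≤1 Y≤T))

    packing : ∃ λ P → IsPacking (suc k₁) L′ P × length P ≡ h ℕ.+ c
    packing with packHuge h S lengthS (ℕ.≤-reflexive kcap+Y) S-ok | pack c R lengthR≤ ktop≤T R-ok
    ... | P , concatP , P-ok , lengthP | Q , concatQ , Q-ok , lengthQ =
      P ++ Q , (concat↭ , All.++⁺ P-ok Q-ok) , trans (length-++ P) (cong₂ ℕ._+_ lengthP lengthQ)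
      where
      concat↭ : concat (P ++ Q) ↭ L′
      concat↭ = begin
        concat (P ++ Q)        ≡⟨ concat-++ P Q ⟨
        concat P ++ concat Q   ≡⟨ cong (concat P ++_) concatQ ⟩
        concat P ++ R          ↭⟨ ↭.++⁺ʳ R concatP ⟩
        (hs ++ S) ++ R         ≡⟨ ++-assoc hs S R ⟩
        hs ++ S ++ R           ↭⟨ ↭.++⁺ˡ hs L↭ ⟨
        hs ++ L                ↭⟨ ↭.++-comm hs L ⟩
        L ++ hs                ∎
        where open PermutationReasoning

    lengthL′ : length L′ ≡ h ℕ.* k₁ ℕ.+ length R ℕ.+ h
    lengthL′ = begin
      length (L ++ hs)              ≡⟨ length-++ L ⟩
      length L ℕ.+ length hs        ≡⟨ cong₂ ℕ._+_ (↭.↭-length L↭) (length-replicate h) ⟩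
      length (S ++ R) ℕ.+ h         ≡⟨ cong (ℕ._+ h) (length-++ S) ⟩
      length S ℕ.+ length R ℕ.+ h   ≡⟨ cong (λ n → n ℕ.+ length R ℕ.+ h) lengthS ⟩
      h ℕ.* k₁ ℕ.+ length R ℕ.+ h   ∎
      where open ≡-Reasoning

    minimal : ∀ P → IsPacking (suc k₁) L′ P → h ℕ.+ c ≤ length P
    minimal P (concat↭ , P-ok) = ℕ.≤-pred (ℕ.*-cancelʳ-< (suc k₁) (h ℕ.+ c) (suc (length P)) (begin-strict
      (h ℕ.+ c) ℕ.* suc k₁                 ≡⟨ ℕ.*-distribʳ-+ (suc k₁) h c ⟩
      h ℕ.* suc k₁ ℕ.+ c ℕ.* suc k₁        ≤⟨ ℕ.+-monoʳ-≤ (h ℕ.* suc k₁) ck≤ ⟩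
      h ℕ.* suc k₁ ℕ.+ (length R ℕ.+ k₁)   ≡⟨ rearrange h k₁ (length R) ⟩
      h ℕ.* k₁ ℕ.+ length R ℕ.+ h ℕ.+ k₁   ≡⟨ cong (ℕ._+ k₁) lengthL′ ⟨
      length L′ ℕ.+ k₁                     ≡⟨ cong (ℕ._+ k₁) (↭.↭-length concat↭) ⟨
      length (concat P) ℕ.+ k₁             ≤⟨ ℕ.+-monoˡ-≤ k₁ (length-concat-≤ (All.map proj₁ P-ok)) ⟩
      length P ℕ.* suc k₁ ℕ.+ k₁           <⟨ ℕ.+-monoʳ-< (length P ℕ.* suc k₁) (ℕ.n<1+n k₁) ⟩
      length P ℕ.* suc k₁ ℕ.+ (suc k₁)     ≡⟨ ℕ.+-comm (length P ℕ.* suc k₁) (suc k₁) ⟩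
      suc (length P) ℕ.* suc k₁            ∎))
      where
      open ℕ.≤-Reasoning
      rearrange : ∀ h k₁ r → h ℕ.* suc k₁ ℕ.+ (r ℕ.+ k₁) ≡ h ℕ.* k₁ ℕ.+ r ℕ.+ h ℕ.+ k₁
      rearrange = ℕ-Solver.solve-∀

    bins′ = run A [] [] L
    cost≥ : h ℕ.+ blocked (suc k₁) (σ Y) bins′ ≤ cost A L′
    cost≥ = begin
      h ℕ.+ blocked (suc k₁) (σ Y) bins′          ≡⟨ blocked-run A L bins′ h 1<2y (0<σ 0<Y) (run-All A [] (All.map (λ (0<x , _) → 0<⇒NonNegSum-preserved 0<x) L-ok) []) ⟨
      blocked (suc k₁) (σ Y) (run A L bins′ hs)   ≤⟨ length-filter (Blocked? (suc k₁) (σ Y)) (run A L bins′ hs) ⟩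
      length (run A L bins′ hs)                   ≡⟨ cong length (run-++ A [] [] L hs) ⟨
      cost A L′                                   ∎
      where
      open ℕ.≤-Reasoning
      1<2y : 1ℚ < σ Y + σ Y
      1<2y = <-≤-trans (1<σ T<2Y) (≤-reflexive (σ-+ Y Y))

  -- The two continuations and the choice between them.

  module Adversary (j : ℕ) (q : ℚ) {p : ℕ} (↥q≡p : ℚ.↥ q ≡ + p)
    (below : p ℕ.* p ℕ.+ p ℕ.* ℚ.↧ₙ q ℕ.* coefficient j ℕ.< ℚ.↧ₙ q ℕ.* ℚ.↧ₙ q ℕ.* constant j)
    (A : OnlineAlg (2 ℕ.+ j)) (K M top : ℕ) (slack<M : slack j p (ℚ.↧ₙ q) ℕ.< M) (2K≤M : 2 ℕ.* K ≤ M)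
    (2ktop≤T : 2 ℕ.* ((2 ℕ.+ j) ℕ.* top) ≤ T) (phase : TinyPhase A [] [] (M ℕ.* (1 ℕ.+ j)) 1 top) where

    open TinyPhase phase

    d k₂ k₁ N : ℕ
    d  = ℚ.↧ₙ q
    k₂ = 2 ℕ.+ j
    k₁ = 1 ℕ.+ j
    N  = M ℕ.* k₁

    X : ℕ
    X = length larges

    final-length : length (run A [] [] items) ≡ X
    final-length = trans (cong length reached) opened

    ktop≤T : k₂ ℕ.* top ≤ T
    ktop≤T = ℕ.≤-trans (ℕ.m≤n*m (k₂ ℕ.* top) 2) 2ktop≤T

    -- The room left by `k - 1` items of size `c`. The first continuation takes `c = top`, the
    -- second the larger huge size given by `c = cap`.
    huge : ℕ → ℕ
    huge c = T ℕ.∸ k₁ ℕ.* c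

    k₁c<ktop : ∀ {c} → c ≤ top → k₁ ℕ.* c ℕ.< k₂ ℕ.* top
    k₁c<ktop c≤top = ℕ.+-mono-≤ (ℕ.≤-trans lo≤cap cap≤top) (ℕ.*-monoʳ-≤ k₁ c≤top)

    k₁c+huge≡T : ∀ {c} → c ≤ top → k₁ ℕ.* c ℕ.+ huge c ≡ T
    k₁c+huge≡T c≤top = ℕ.m+[n∸m]≡n (ℕ.≤-trans (ℕ.<⇒≤ (k₁c<ktop c≤top)) ktop≤T)

    -- The factor 2 in `2ktop≤T` keeps `k₁ * c` below half of `T`, so a huge item exceeds half a
    -- bin.
    T<huge+huge : ∀ {c} → c ≤ top → T ℕ.< huge c ℕ.+ huge c
    T<huge+huge {c} c≤top = ℕ.+-cancelˡ-< (2 ℕ.* (k₁ ℕ.* c)) T (huge c ℕ.+ huge c) (begin-strict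
      2 ℕ.* (k₁ ℕ.* c) ℕ.+ T                            <⟨ ℕ.+-monoˡ-< T (ℕ.<-≤-trans (ℕ.*-monoʳ-< 2 (k₁c<ktop c≤top)) 2ktop≤T) ⟩
      T ℕ.+ T                                           ≡⟨ cong₂ ℕ._+_ (k₁c+huge≡T c≤top) (k₁c+huge≡T c≤top) ⟨
      (k₁ ℕ.* c ℕ.+ huge c) ℕ.+ (k₁ ℕ.* c ℕ.+ huge c)   ≡⟨ identity (k₁ ℕ.* c) (huge c) ⟩
      2 ℕ.* (k₁ ℕ.* c) ℕ.+ (huge c ℕ.+ huge c)          ∎)
      where
      open ℕ.≤-Reasoning
      identity : ∀ a Y → (a ℕ.+ Y) ℕ.+ (a ℕ.+ Y) ≡ 2 ℕ.* a ℕ.+ (Y ℕ.+ Y)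
      identity = ℕ-Solver.solve-∀

    Kk≤N : K ℕ.* k₂ ≤ N
    Kk≤N = begin
      K ℕ.* (2 ℕ.+ j)               ≤⟨ ℕ.m≤m+n _ (K ℕ.* j) ⟩
      K ℕ.* (2 ℕ.+ j) ℕ.+ K ℕ.* j   ≡⟨ identity K j ⟩
      2 ℕ.* K ℕ.* (1 ℕ.+ j)         ≤⟨ ℕ.*-monoˡ-≤ k₁ 2K≤M ⟩
      N                             ∎
      where
      open ℕ.≤-Reasoning
      identity : ∀ K j → K ℕ.* (2 ℕ.+ j) ℕ.+ K ℕ.* j ≡ 2 ℕ.* K ℕ.* (1 ℕ.+ j)
      identity = ℕ-Solver.solve-∀

    F : ℕ
    F = blocked k₂ (σ (huge top)) (run A [] [] items)

    -- As `N = k₁ M`, this gives at least `k₁ (M - X)` bins useless for the first continuation.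
    N≤k₁X+F : N ≤ k₁ ℕ.* X ℕ.+ F
    N≤k₁X+F = begin
      N                                         ≡⟨ count ⟨
      length items                              ≡⟨ ℕ.+-identityʳ (length items) ⟨
      length items ℕ.+ 0                        ≡⟨ length-concat-run A [] [] items ⟨
      length (concat (run A [] [] items))       ≤⟨ length-concat-≤-blocked _ (run-All A [] (All.universal (λ _ → length≤-preserved (s≤s z≤n)) items) []) ⟩
      k₁ ℕ.* length (run A [] [] items) ℕ.+ F   ≡⟨ cong (λ n → k₁ ℕ.* n ℕ.+ F) final-length ⟩
      k₁ ℕ.* X ℕ.+ F                            ∎
      where open ℕ.≤-Reasoning

    items≤ : All (Within top) items
    items≤ = ↭.All-resp-↭ (↭-sym partition) (All.++⁺ (All.map (within-weaken cap≤top) smalls≤) larges≤)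

    -- All `N = M k₁` tiny items accompany the `M` huge ones and `R` is empty, so the optimum is
    -- `M`.
    smallHuge : p ℕ.* M ℕ.< d ℕ.* (M ℕ.+ F) → Refutes A q K
    smallHuge pM< = refutes q ↥q≡p A
      (attack {cap = top} {top} {huge top} A items items [] M 0 (↭-reflexive (sym (++-identityʳ items))) count z≤n z≤n
        items≤ [] ℕ.≤-refl ktop≤T (k₁c+huge≡T {top} ℕ.≤-refl) (T<huge+huge {top} ℕ.≤-refl))
      (subst (K ≤_) M≡M+0 (ℕ.≤-trans (ℕ.m≤n*m K 2) 2K≤M))
      (subst (λ m → p ℕ.* m ℕ.< d ℕ.* (M ℕ.+ F)) M≡M+0 pM<)
      where
      M≡M+0 : M ≡ M ℕ.+ 0
      M≡M+0 = sym (ℕ.+-identityʳ M)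

    -- A bin has load at least `k cap`, and adding `T - (k - 1) cap` gives `T + cap`, which is more
    -- than `T`.
    all-blocked : blocked k₂ (σ (huge cap)) (run A [] [] items) ≡ X
    all-blocked = trans (cong length (filter-all (Blocked? k₂ (σ (huge cap))) (All.map (λ {b} → unfit {b}) (subst (All _) (sym reached) heavy)))) final-length
      where
      T< : T ℕ.< cap ℕ.* k₂ ℕ.+ huge cap
      T< = begin-strict
        T                                   <⟨ ℕ.+-monoˡ-≤ T lo≤cap ⟩
        cap ℕ.+ T                           ≡⟨ cong (cap ℕ.+_) (k₁c+huge≡T cap≤top) ⟨
        cap ℕ.+ (k₁ ℕ.* cap ℕ.+ huge cap)   ≡⟨ ℕ.+-assoc cap (k₁ ℕ.* cap) (huge cap) ⟨
        k₂ ℕ.* cap ℕ.+ huge cap             ≡⟨ cong (ℕ._+ huge cap) (ℕ.*-comm k₂ cap) ⟩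
        cap ℕ.* k₂ ℕ.+ huge cap             ∎
        where open ℕ.≤-Reasoning
      unfit : ∀ {b : Bin} → σ (cap ℕ.* k₂) ℚ.≤ sumℚ b → ¬ Fits k₂ b (σ (huge cap))
      unfit {b} ≤b (_ , b+y≤1) = <⇒≱ (1<σ T<) (begin
        σ (cap ℕ.* k₂ ℕ.+ huge cap)     ≡⟨ σ-+ (cap ℕ.* k₂) (huge cap) ⟩
        σ (cap ℕ.* k₂) + σ (huge cap)   ≤⟨ +-monoˡ-≤ (σ (huge cap)) ≤b ⟩
        sumℚ b + σ (huge cap)           ≤⟨ b+y≤1 ⟩
        1ℚ                              ∎)
        where open ≤-Reasoning

    -- The last hypothesis says that the first continuation fails; through `N≤k₁X+F` it bounds `X`
    -- from below. Multiplying by `k` replaces the rounded optimum by `N + h + k₁`, which reduces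
    -- the claim to `largeHuge-inequality`.
    largeHuge : ∀ h c S R → items ↭ S ++ R → length S ≡ h ℕ.* k₁ →
      length R ≤ c ℕ.* k₂ → c ℕ.* k₂ ≤ length R ℕ.+ k₁ → All (Within cap) S → All (Within top) R →
      N ≤ k₁ ℕ.* h ℕ.+ j ℕ.+ X → d ℕ.* (M ℕ.+ F) ≤ p ℕ.* M → Refutes A q K
    largeHuge h c S R items↭ lengthS r≤ck ck≤ S-ok R-ok N≤ ≤pM = refutes q ↥q≡p A
      (attack {cap = cap} {top} {huge cap} A items S R h c items↭ lengthS r≤ck ck≤ S-ok R-ok
        cap≤top ktop≤T (k₁c+huge≡T cap≤top) (T<huge+huge cap≤top))
      K≤m pm<
      where
      r : ℕ
      r = length R
      N≡ : N ≡ h ℕ.* k₁ ℕ.+ r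
      N≡ = trans (sym count) (trans (↭.↭-length items↭) (trans (length-++ S) (cong (ℕ._+ r) lengthS)))
      K≤m : K ≤ h ℕ.+ c
      K≤m = ℕ.*-cancelʳ-≤ K (h ℕ.+ c) k₂ (begin
        K ℕ.* k₂                ≤⟨ Kk≤N ⟩
        N                       ≡⟨ N≡ ⟩
        h ℕ.* k₁ ℕ.+ r          ≤⟨ ℕ.+-mono-≤ (ℕ.*-monoʳ-≤ h (ℕ.n≤1+n k₁)) r≤ck ⟩
        h ℕ.* k₂ ℕ.+ c ℕ.* k₂   ≡⟨ ℕ.*-distribʳ-+ k₂ h c ⟨
        (h ℕ.+ c) ℕ.* k₂        ∎)
        where open ℕ.≤-Reasoning
      mk≤ : (h ℕ.+ c) ℕ.* k₂ ≤ N ℕ.+ h ℕ.+ k₁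
      mk≤ = begin
        (h ℕ.+ c) ℕ.* k₂              ≡⟨ ℕ.*-distribʳ-+ k₂ h c ⟩
        h ℕ.* k₂ ℕ.+ c ℕ.* k₂         ≤⟨ ℕ.+-monoʳ-≤ (h ℕ.* k₂) ck≤ ⟩
        h ℕ.* k₂ ℕ.+ (r ℕ.+ k₁)       ≡⟨ identity h j r ⟩
        h ℕ.* k₁ ℕ.+ r ℕ.+ h ℕ.+ k₁   ≡⟨ cong (λ n → n ℕ.+ h ℕ.+ k₁) N≡ ⟨
        N ℕ.+ h ℕ.+ k₁                ∎
        where
        open ℕ.≤-Reasoning
        identity : ∀ h j r → h ℕ.* (2 ℕ.+ j) ℕ.+ (r ℕ.+ (1 ℕ.+ j)) ≡ h ℕ.* (1 ℕ.+ j) ℕ.+ r ℕ.+ h ℕ.+ (1 ℕ.+ j)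
        identity = ℕ-Solver.solve-∀
      Mdk≤ : M ℕ.* (d ℕ.* k₂) ≤ p ℕ.* M ℕ.+ d ℕ.* k₁ ℕ.* X
      Mdk≤ = begin
        M ℕ.* (d ℕ.* k₂)                     ≡⟨ identity₁ M d j ⟩
        d ℕ.* (N ℕ.+ M)                      ≤⟨ ℕ.*-monoʳ-≤ d (ℕ.+-monoˡ-≤ M N≤k₁X+F) ⟩
        d ℕ.* (k₁ ℕ.* X ℕ.+ F ℕ.+ M)         ≡⟨ identity₂ d k₁ X F M ⟩
        d ℕ.* (M ℕ.+ F) ℕ.+ d ℕ.* k₁ ℕ.* X   ≤⟨ ℕ.+-monoˡ-≤ (d ℕ.* k₁ ℕ.* X) ≤pM ⟩
        p ℕ.* M ℕ.+ d ℕ.* k₁ ℕ.* X           ∎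
        where
        open ℕ.≤-Reasoning
        identity₁ : ∀ M d j → M ℕ.* (d ℕ.* (2 ℕ.+ j)) ≡ d ℕ.* (M ℕ.* (1 ℕ.+ j) ℕ.+ M)
        identity₁ = ℕ-Solver.solve-∀
        identity₂ : ∀ d k₁ X F M → d ℕ.* (k₁ ℕ.* X ℕ.+ F ℕ.+ M) ≡ d ℕ.* (M ℕ.+ F) ℕ.+ d ℕ.* k₁ ℕ.* X
        identity₂ = ℕ-Solver.solve-∀
      pm< : p ℕ.* (h ℕ.+ c) ℕ.< d ℕ.* (h ℕ.+ blocked k₂ (σ (huge cap)) (run A [] [] items))
      pm< = subst (λ n → p ℕ.* (h ℕ.+ c) ℕ.< d ℕ.* n) (trans (ℕ.+-comm X h) (cong (h ℕ.+_) (sym all-blocked)))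
        (ℕ.*-cancelʳ-< k₂ (p ℕ.* (h ℕ.+ c)) (d ℕ.* (X ℕ.+ h)) (begin-strict
          p ℕ.* (h ℕ.+ c) ℕ.* k₂     ≡⟨ ℕ.*-assoc p (h ℕ.+ c) k₂ ⟩
          p ℕ.* ((h ℕ.+ c) ℕ.* k₂)   ≤⟨ ℕ.*-monoʳ-≤ p mk≤ ⟩
          p ℕ.* (N ℕ.+ h ℕ.+ k₁)     <⟨ largeHuge-inequality j p d M X h below slack<M N≤ Mdk≤ ⟩
          d ℕ.* k₂ ℕ.* (X ℕ.+ h)     ≡⟨ identity d k₂ (X ℕ.+ h) ⟩
          d ℕ.* (X ℕ.+ h) ℕ.* k₂     ∎))
        where
        open ℕ.≤-Reasoning
        identity : ∀ d k x → d ℕ.* k ℕ.* x ≡ d ℕ.* x ℕ.* k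
        identity = ℕ-Solver.solve-∀

    refutation : Refutes A q K
    -- Either the first continuation wins, or its failure is the last hypothesis of `largeHuge`.
    refutation = [ smallHuge , largeHuge h c S R items↭ (take-length-≡ (ℕ.m/n*n≤m s k₁)) r≤ck (ℕ.m/n*n≤m (r ℕ.+ k₁) k₂)
        (All.take⁺ (h ℕ.* k₁) smalls≤)
        (All.++⁺ (All.map (within-weaken cap≤top) (All.drop⁺ (h ℕ.* k₁) smalls≤)) larges≤)
        N≤ ]′ (ℕ.<-≤-connex (p ℕ.* M) (d ℕ.* (M ℕ.+ F)))
      where
      s h r c : ℕ
      S R : List ℚ
      s = length smalls
      -- One huge item per complete group of `k₁` small ones; the fewer than `k₁` remaining small
      -- items join the large ones in `R`.
      h = s ℕ./ k₁
      S = take (h ℕ.* k₁) smalls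
      R = drop (h ℕ.* k₁) smalls ++ larges
      r = length R
      -- As `k₁ = k₂ - 1`, this is `r / k₂` rounded up.
      c = (r ℕ.+ k₁) ℕ./ k₂
      items↭ : items ↭ S ++ R
      items↭ = begin
        items                                     ↭⟨ partition ⟩
        smalls ++ larges                          ≡⟨ cong (_++ larges) (take++drop≡id (h ℕ.* k₁) smalls) ⟨
        (S ++ drop (h ℕ.* k₁) smalls) ++ larges   ≡⟨ ++-assoc S _ larges ⟩
        S ++ R                                    ∎
        where open PermutationReasoning
      r≤ck : r ≤ c ℕ.* k₂
      r≤ck = ℕ.+-cancelʳ-≤ k₂ r (c ℕ.* k₂) (begin
        r ℕ.+ k₂          ≡⟨ ℕ.+-suc r k₁ ⟩
        suc (r ℕ.+ k₁)    ≤⟨ m<[1+m/n]*n (r ℕ.+ k₁) k₂ ⟩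
        suc c ℕ.* k₂      ≡⟨ ℕ.+-comm k₂ (c ℕ.* k₂) ⟩
        c ℕ.* k₂ ℕ.+ k₂   ∎)
        where open ℕ.≤-Reasoning
      N≤ : N ≤ k₁ ℕ.* h ℕ.+ j ℕ.+ X
      N≤ = begin
        N                      ≡⟨ trans (sym count) (trans (↭.↭-length partition) (length-++ smalls)) ⟩
        -- The strict bound `s < k₁ + h * k₁` with `k₁ = 1 + j` loses only `j`, the largest possible
        -- remainder.
        s ℕ.+ X                ≤⟨ ℕ.+-monoˡ-≤ X (ℕ.≤-pred (m<[1+m/n]*n s k₁)) ⟩
        j ℕ.+ h ℕ.* k₁ ℕ.+ X   ≡⟨ cong (ℕ._+ X) (trans (ℕ.+-comm j (h ℕ.* k₁)) (cong (ℕ._+ j) (ℕ.*-comm h k₁))) ⟩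
        k₁ ℕ.* h ℕ.+ j ℕ.+ X   ∎
        where open ℕ.≤-Reasoning

-- Choice of the parameters and conclusion.

-- The order of choice matters: `M` exceeds the slack and is at least `2 K`, which fixes the number
-- `N` of tiny items; starting from `lo = 1`, `N` fixes `top`; last comes the resolution `T`, so
-- fine that `k` items of size `top` fill at most half a bin.
refute-nonNeg : ∀ j q {p} → ℚ.↥ q ≡ + p →
  p ℕ.* p ℕ.+ p ℕ.* ℚ.↧ₙ q ℕ.* coefficient j ℕ.< ℚ.↧ₙ q ℕ.* ℚ.↧ₙ q ℕ.* constant j →
  (A : OnlineAlg (2 ℕ.+ j)) → ∀ K → Refutes A q K
refute-nonNeg j q {p} ↥q≡p below A K = Adversary.refutation j q ↥q≡p below A K M top
    (s≤s (ℕ.m≤m+n s (2 ℕ.* K))) (ℕ.m≤n⇒m≤1+n (ℕ.m≤n+m (2 ℕ.* K) s)) ℕ.≤-refl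
    (tinyPhase A [] [] N 1 (s≤s z≤n) ℕ.≤-refl [])
  where
  s M N top T : ℕ
  s   = slack j p (ℚ.↧ₙ q)
  M   = suc (s ℕ.+ 2 ℕ.* K)
  N   = M ℕ.* (1 ℕ.+ j)
  top = 1 ℕ.* gap (2 ℕ.+ j) N
  T   = 2 ℕ.* ((2 ℕ.+ j) ℕ.* top)
  1≤top : 1 ≤ top
  1≤top = ℕ.*-mono-≤ (ℕ.≤-refl {1}) (gap-positive N (s≤s z≤n))
  open Game T {{ℕ.>-nonZero (ℕ.*-mono-≤ (s≤s (z≤n {1})) (ℕ.*-mono-≤ (s≤s (z≤n {1 ℕ.+ j})) 1≤top))}}

constant-positive : ∀ j → 1 ≤ constant j
constant-positive j = ℕ.≤-trans (s≤s z≤n) (ℕ.m≤n+m (2 ℕ.+ j) _)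

refute : ∀ j q → BelowBound (2 ℕ.+ j) q → (A : OnlineAlg (2 ℕ.+ j)) → ∀ K → Refutes A q K
refute j q@(mkℚ (+ p) _ _) below A K = refute-nonNeg j q refl (BelowBound⇒ j q refl below) A K
-- A negative `q` is refuted along with 0, which lies below the bound because the constant is
-- positive.
refute j q@(mkℚ -[1+ _ ] _ _) below A K = refutes-mono (<⇒≤ (negative⁻¹ q)) A
  (refute-nonNeg j 0ℚ refl (ℕ.≤-trans (constant-positive j) (ℕ.≤-reflexive (sym (ℕ.*-identityˡ (constant j))))) A K)

theorem6 : (k : ℕ) → 3 ≤ k → (A : OnlineAlg k) →
    (q : ℚ) → BelowBound k q → (K : ℕ) →
    Σ (List ℚ) λ L → All ValidItem L × ∃ λ m →
    IsOPT k L m × K ≤ m × q * ℕtoℚ m < ℕtoℚ (cost A L)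
theorem6 (suc (suc j)) _ A q below K = refute j q below A K
theorem6 (suc zero) (s≤s ())
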